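{- Let $k$ be a nonnegative integer. Then there exist rational numbers $\xi_\nu$, indexed by integer partitions $\nu$ with $|\nu|\le k$, such that for every $m\ge0$ and all real numbers $a_0<a_1<\cdots<a_m$ and $b_1<b_2<\cdots<b_m$, $$\sum_{0\le i\le m}\frac{\prod_{1\le j\le m}(a_i-b_j)}{\prod_{0\le j\le m,\ j\ne i}(a_i-a_j)}\,a_i^k=\sum_{|\nu|\le k}\xi_\nu\, q_\nu(\{a_i\},\{b_i\}).$$
   Context: For numbers $a_0,\dots,a_m$ and $b_1,\dots,b_m$ and $k\ge0$, set $q_k(\{a_i\},\{b_i\})=\sum_{i=0}^m a_i^k-\sum_{i=1}^m b_i^k$. For an integer partition $\nu=(\nu_1,\dots,\nu_\ell)$ (a weakly decreasing finite sequence of positive integers, $|\nu|=\sum\nu_j$), set $q_\nu(\{a_i\},\{b_i\})=\prod_{j=1}^{\ell}q_{\nu_j}(\{a_i\},\{b_i\})$, with $q_\emptyset=1$. -}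

module Defs where

open import Level using (_⊔_) renaming (suc to lsuc)
open import Algebra.Apartness.Bundles using (HeytingField)
open import Algebra.Bundles using (CommutativeRing; Semiring)
import Algebra.Apartness.Properties.HeytingCommutativeRing as HeytingProperties
import Algebra.Definitions.RawSemiring as RawSemiringDefinitions
import Algebra.Properties.Ring as RingProperties
open import Data.Fin.Base using (Fin; punchIn) renaming (zero to fzero; suc to fsuc; _<_ to _<ᶠ_)
open import Data.Fin.Properties using (punchInᵢ≢i) renaming (<-cmp to <ᶠ-cmp)
open import Data.Integer.Base as ℤ using (ℤ)
open import Data.List.Base as List using (List; []; _∷_; applyUpTo; cartesianProductWith; filter)
open import Data.List.Membership.Propositional using (_∈_)
open import Data.List.Membership.Propositional.Properties
  using (∈-applyUpTo⁺; ∈-cartesianProductWith⁺; ∈-cartesianProductWith⁻; ∈-filter⁺; ∈-map⁻)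
open import Data.List.Properties using (∷-injective)
open import Data.List.Relation.Unary.All as All using (All; []; _∷_)
open import Data.List.Relation.Unary.All.Properties using (all-filter)
open import Data.List.Relation.Unary.AllPairs using ([]; _∷_)
open import Data.List.Relation.Unary.Any using (here; there)
open import Data.List.Relation.Unary.Linked using (Linked; linked?)
open import Data.List.Relation.Unary.Unique.Propositional using (Unique)
import Data.List.Relation.Unary.Unique.Propositional.Properties as Uniqueₚ
open import Data.Nat.Base as ℕ using (ℕ; zero; suc; z≤n; s≤s)
import Data.Nat.Properties as ℕₚ
open import Data.Product.Base using (_×_; _,_; proj₁; ∃-syntax)
open import Data.Rational.Base using (ℚ; mkℚ)
open import Data.Sum.Base using (_⊎_; inj₁; inj₂)
open import Data.Vec.Functional using (Vector)
open import Function.Base using (_∘_)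
open import Function.Bundles using (_⇔_; Equivalence)
open import Relation.Binary.Core using (Rel)
open import Relation.Binary.Definitions using (tri<; tri≈; tri>)
open import Relation.Binary.PropositionalEquality.Core as ≡ using (_≡_; _≢_)
open import Relation.Binary.Structures using (IsStrictPartialOrder)
open import Relation.Nullary.Decidable using (Dec; _×-dec_; recompute)
open import Relation.Nullary.Negation using (contradiction)

------------------------------------------------------------------------
-- The real numbers, as a Cauchy-complete Archimedean ordered field.
--
-- Classically these axioms determine ℝ up to isomorphism.  They are
-- phrased constructively (apartness, Cauchy moduli as witnesses), so that
-- Cauchy sequences of rationals with moduli, under the usual equality,
-- satisfy them without any classical assumption.

record RealNumbers c ℓ₁ ℓ₂ : Set (lsuc (c ⊔ ℓ₁ ⊔ ℓ₂)) where
  infix 4 _<_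
  field
    heytingField : HeytingField c ℓ₁ ℓ₂

  open HeytingField heytingField public

  commutativeRing : CommutativeRing c ℓ₁
  commutativeRing = record { isCommutativeRing = isCommutativeRing }

  open RawSemiringDefinitions (Semiring.rawSemiring (CommutativeRing.semiring commutativeRing)) public
    using (_^_; sum; product) renaming (_×_ to _·_)

  field
    _<_                  : Rel Carrier ℓ₂
    isStrictPartialOrder : IsStrictPartialOrder _≈_ _<_
    #⇔<⊎>                : ∀ {x y} → x # y ⇔ (x < y ⊎ y < x)
    +-monoˡ-<            : ∀ z {x y} → x < y → x + z < y + z
    *-pos                : ∀ {x y} → 0# < x → 0# < y → 0# < x * y
    archimedean          : ∀ x → ∃[ n ] x < n · 1#

  IsCauchy : (ℕ → Carrier) → Set (c ⊔ ℓ₂)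
  IsCauchy x = ∀ ε → 0# < ε →
    ∃[ N ] (∀ i j → N ℕ.≤ i → N ℕ.≤ j → x i - x j < ε)

  _ConvergesTo_ : (ℕ → Carrier) → Carrier → Set (c ⊔ ℓ₂)
  x ConvergesTo l = ∀ ε → 0# < ε →
    ∃[ N ] (∀ i → N ℕ.≤ i → (x i - l < ε) × (l - x i < ε))

  field
    complete : ∀ x → IsCauchy x → ∃[ l ] (x ConvergesTo l)

------------------------------------------------------------------------
-- Integer partitions

record Partition : Set where
  constructor mkPartition
  field
    parts       : List ℕ
    .decreasing : Linked ℕ._≥_ parts
    .positive   : All (0 ℕ.<_) parts

open Partition public

∣_∣ : Partition → ℕ
∣ ν ∣ = List.sum (parts ν)

IsPartitionUpTo : ℕ → List ℕ → Set
IsPartitionUpTo k xs = (Linked ℕ._≥_ xs × All (0 ℕ.<_) xs) × List.sum xs ℕ.≤ k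

isPartitionUpTo? : ∀ k xs → Dec (IsPartitionUpTo k xs)
isPartitionUpTo? k xs =
  (linked? (λ x y → y ℕₚ.≤? x) xs ×-dec All.all? (0 ℕₚ.<?_) xs)
    ×-dec (List.sum xs ℕₚ.≤? k)

-- All lists of length at most n with entries in {1,…,b}.
words : (n b : ℕ) → List (List ℕ)
words zero    b = [] ∷ []
words (suc n) b = [] ∷ cartesianProductWith _∷_ (applyUpTo suc b) (words n b)

toPartition : ∀ k {xs} → IsPartitionUpTo k xs → Partition
toPartition k {xs} ((dec , pos) , _) = mkPartition xs dec pos

-- All partitions ν with ∣ ν ∣ ≤ k, each exactly once; see the three
-- lemmas below.
partitionsUpTo : ℕ → List Partition
partitionsUpTo k =
  All.reduce (toPartition k) (all-filter (isPartitionUpTo? k) (words k k))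

words-complete : ∀ n b xs → All (0 ℕ.<_) xs → List.sum xs ℕ.≤ n →
                 List.sum xs ℕ.≤ b → xs ∈ words n b
words-complete zero    b []           _         _       _   = here ≡.refl
words-complete (suc n) b []           _         _       _   = here ≡.refl
words-complete zero    b (suc x ∷ xs) _         ()      _
words-complete _       b (zero ∷ xs)  (() ∷ _)
words-complete (suc n) b (suc x ∷ xs) (_ ∷ pos) (s≤s p) q   = there
  (∈-cartesianProductWith⁺ _∷_
    (∈-applyUpTo⁺ suc (ℕₚ.≤-trans (ℕₚ.m≤m+n (suc x) (List.sum xs)) q))
    (words-complete n b xs pos (ℕₚ.≤-trans (ℕₚ.m≤n+m (List.sum xs) x) p)
                               (ℕₚ.≤-trans (ℕₚ.m≤n+m (List.sum xs) (suc x)) q)))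

words-unique : ∀ n b → Unique (words n b)
words-unique zero    b = [] ∷ []
words-unique (suc n) b =
  All.tabulate nonempty ∷
  Uniqueₚ.cartesianProductWith⁺ _∷_ ∷-injective
    (Uniqueₚ.applyUpTo⁺₁ suc b (λ i<j _ → ℕₚ.<⇒≢ i<j ∘ ℕₚ.suc-injective))
    (words-unique n b)
  where
  nonempty : ∀ {xs} → xs ∈ cartesianProductWith _∷_ (applyUpTo suc b) (words n b) →
             [] ≢ xs
  nonempty xs∈ with ∈-cartesianProductWith⁻ _∷_ (applyUpTo suc b) (words n b) xs∈
  ... | _ , _ , _ , _ , ≡.refl = λ ()

parts-injective : ∀ {μ ν} → parts μ ≡ parts ν → μ ≡ ν
parts-injective ≡.refl = ≡.refl

map-parts-reduce : ∀ k {xss} (ps : All (IsPartitionUpTo k) xss) →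
                   List.map parts (All.reduce (toPartition k) ps) ≡ xss
map-parts-reduce k []       = ≡.refl
map-parts-reduce k (p ∷ ps) = ≡.cong (_ ∷_) (map-parts-reduce k ps)

partitionsUpTo-sound : ∀ k {ν} → ν ∈ partitionsUpTo k → ∣ ν ∣ ℕ.≤ k
partitionsUpTo-sound k = go (all-filter (isPartitionUpTo? k) (words k k))
  where
  go : ∀ {xss ν} (ps : All (IsPartitionUpTo k) xss) →
       ν ∈ All.reduce (toPartition k) ps → ∣ ν ∣ ℕ.≤ k
  go ((_ , le) ∷ ps) (here ≡.refl) = le
  go (_ ∷ ps)        (there ν∈)    = go ps ν∈

partitionsUpTo-complete : ∀ k ν → ∣ ν ∣ ℕ.≤ k → ν ∈ partitionsUpTo k
partitionsUpTo-complete k ν@(mkPartition xs dec pos) ∣ν∣≤k =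
  let μ , μ∈ , xs≡ = ∈-map⁻ parts
        (≡.subst (xs ∈_)
          (≡.sym (map-parts-reduce k (all-filter (isPartitionUpTo? k) (words k k))))
          (∈-filter⁺ (isPartitionUpTo? k)
            (words-complete k k xs pos′ ∣ν∣≤k ∣ν∣≤k)
            ((dec′ , pos′) , ∣ν∣≤k)))
  in ≡.subst (_∈ partitionsUpTo k) (parts-injective (≡.sym xs≡)) μ∈
  where
  pos′ : All (0 ℕ.<_) xs
  pos′ = recompute (All.all? (0 ℕₚ.<?_) xs) pos
  dec′ : Linked ℕ._≥_ xs
  dec′ = recompute (linked? (λ x y → y ℕₚ.≤? x) xs) dec

partitionsUpTo-unique : ∀ k → Unique (partitionsUpTo k)
partitionsUpTo-unique k = Uniqueₚ.map⁻ {f = parts}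
  (≡.subst Unique
    (≡.sym (map-parts-reduce k (all-filter (isPartitionUpTo? k) (words k k))))
    (Uniqueₚ.filter⁺ (isPartitionUpTo? k) (words-unique k k)))

------------------------------------------------------------------------
-- Notation over the reals

module RealNotation {c ℓ₁ ℓ₂} (R : RealNumbers c ℓ₁ ℓ₂) where

  open RealNumbers R public
  open HeytingProperties heytingCommutativeRing using (1#0; x#0y#0→xy#0)
  open RingProperties (CommutativeRing.ring commutativeRing)
    using (-‿distribˡ-*; -‿involutive)
  module < = IsStrictPartialOrder isStrictPartialOrder

  ℝ : Set c
  ℝ = Carrier

  -- The library's inverse is one of y - 0#, which is ≈ y.
  infixl 7 _/_[_]
  _/_[_] : (x y : ℝ) → y # 0# → ℝ
  x / y [ y#0 ] = x * proj₁ (#⇒invertible y#0)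

  0<1 : 0# < 1#
  0<1 with Equivalence.to #⇔<⊎> 1#0
  ... | inj₂ 0<1 = 0<1
  ... | inj₁ 1<0 = <.<-respʳ-≈ [-1][-1]≈1 (*-pos 0<-1 0<-1)
    where
    0<-1 : 0# < - 1#
    0<-1 = <.<-respʳ-≈ (+-identityˡ _)
             (<.<-respˡ-≈ (-‿inverseʳ 1#) (+-monoˡ-< (- 1#) 1<0))
    [-1][-1]≈1 : - 1# * - 1# ≈ 1#
    [-1][-1]≈1 = trans (sym (-‿distribˡ-* 1# (- 1#)))
                   (trans (-‿cong (*-identityˡ (- 1#))) (-‿involutive 1#))

  0<suc·1 : ∀ n → 0# < suc n · 1#
  0<suc·1 zero    = <.<-respʳ-≈ (sym (+-identityʳ 1#)) 0<1
  0<suc·1 (suc n) = <.trans (0<suc·1 n)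
    (<.<-respˡ-≈ (+-identityˡ _) (+-monoˡ-< (suc n · 1#) 0<1))

  fromℤ : ℤ → ℝ
  fromℤ (ℤ.+ n)      = n · 1#
  fromℤ (ℤ.-[1+ n ]) = - (suc n · 1#)

  fromℚ : ℚ → ℝ
  fromℚ (mkℚ num den-1 _) =
    fromℤ num / suc den-1 · 1# [ Equivalence.from #⇔<⊎> (inj₂ (0<suc·1 den-1)) ]

  StrictlyIncreasing : ∀ {n} → Vector ℝ n → Set ℓ₂
  StrictlyIncreasing a = ∀ {i j} → i <ᶠ j → a i < a j

  sumOver : ∀ {A : Set} → List A → (A → ℝ) → ℝ
  sumOver xs f = List.foldr (λ x s → f x + s) 0# xs

  powerDiff : ∀ {m} → ℕ → Vector ℝ (suc m) → Vector ℝ m → ℝ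
  powerDiff k a b = sum (λ i → a i ^ k) - sum (λ i → b i ^ k)

  q : ∀ {m} → Partition → Vector ℝ (suc m) → Vector ℝ m → ℝ
  q ν a b = List.foldr (λ νⱼ p → powerDiff νⱼ a b * p) 1# (parts ν)

  -- ∏_{j ≠ i} (a i - a j): punchIn i enumerates the indices j ≠ i.
  denominator : ∀ {m} → Vector ℝ (suc m) → Fin (suc m) → ℝ
  denominator a i = product (λ j → a i - a (punchIn i j))

  product#0 : ∀ {n} (x : Vector ℝ n) → (∀ i → x i # 0#) → product x # 0#
  product#0 {zero}  x x#0 = 1#0
  product#0 {suc n} x x#0 =
    x#0y#0→xy#0 (x#0 fzero) (product#0 (x ∘ fsuc) (x#0 ∘ fsuc))

  x#y⇒x-y#0 : ∀ {x y} → x # y → (x - y) # 0#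
  x#y⇒x-y#0 {x} {y} x#y with Equivalence.to #⇔<⊎> x#y
  ... | inj₁ x<y = Equivalence.from #⇔<⊎>
          (inj₁ (<.<-respʳ-≈ (-‿inverseʳ y) (+-monoˡ-< (- y) x<y)))
  ... | inj₂ y<x = Equivalence.from #⇔<⊎>
          (inj₂ (<.<-respˡ-≈ (-‿inverseʳ y) (+-monoˡ-< (- y) y<x)))

  increasing⇒# : ∀ {n} {a : Vector ℝ n} → StrictlyIncreasing a →
                 ∀ {i j} → i ≢ j → a i # a j
  increasing⇒# a↑ {i} {j} i≢j with <ᶠ-cmp i j
  ... | tri< i<j _ _ = Equivalence.from #⇔<⊎> (inj₁ (a↑ i<j))
  ... | tri≈ _ i≡j _ = contradiction i≡j i≢j
  ... | tri> _ _ j<i = Equivalence.from #⇔<⊎> (inj₂ (a↑ j<i))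

  denominator#0 : ∀ {m} {a : Vector ℝ (suc m)} → StrictlyIncreasing a →
                  ∀ i → denominator a i # 0#
  denominator#0 a↑ i = product#0 _
    (λ j → x#y⇒x-y#0 (increasing⇒# a↑ (punchInᵢ≢i i j ∘ ≡.sym)))

{-# OPTIONS --safe #-}
module Submission where

-- Let Hₖ(a;b) be the left-hand side.  Since Π(x - bⱼ) is monic of degree m,
-- its divided difference at a₀,…,aₘ gives H₀ = 1.  Cancelling the factor
-- aᵢ - a₀ against the denominators, and bringing in x - b₁, relates H to the
-- same quantity H′ for the points without a₀ and b₁:
--   Hₖ₊₁ - a₀ Hₖ = H′ₖ₊₁ - b₁ H′ₖ.
-- So (1 - a₀ z) H(z) = (1 - b₁ z) H′(z) for the generating functions, and
-- induction on m yields Newton's identities (k+1) Hₖ₊₁ = Σ q_{r+1} Hₖ₋ᵣ, which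
-- compute Hₖ recursively as a rational combination of the q_ν.

open import Defs
open import Algebra.Bundles using (CommutativeRing)
import Algebra.Properties.AbelianGroup as AbelianGroupProperties
import Algebra.Properties.CommutativeMonoid.Sum as CommutativeMonoidSum
import Algebra.Properties.Ring as RingProperties
import Algebra.Properties.Semiring.Mult as SemiringMult
import Algebra.Properties.Semiring.Sum as SemiringSum
import Algebra.Solver.Ring as RingSolver
open import Algebra.Solver.Ring.AlmostCommutativeRing
  using (fromCommutativeRing; _-Raw-AlmostCommutative⟶_)
open import Data.Fin.Base using (punchIn) renaming (zero to fzero; suc to fsuc)
open import Data.Integer.Base as ℤ using (ℤ)
import Data.Integer.Properties as ℤₚ
open import Data.List.Base as List using (List; []; _∷_)
open import Data.List.Membership.Propositional using (_∈_)
open import Data.List.Properties using (≡-dec)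
open import Data.List.Relation.Binary.Permutation.Propositional as ↭ using (_↭_; ↭-sym)
open import Data.List.Relation.Binary.Permutation.Propositional.Properties using (All-resp-↭)
open import Data.List.Relation.Unary.All as All using (All; []; _∷_)
open import Data.List.Relation.Unary.AllPairs using (_∷_)
open import Data.List.Relation.Unary.Linked using ([])
open import Data.List.Relation.Unary.Any using (here; there)
open import Data.List.Relation.Unary.Unique.Propositional using (Unique)
import Data.List.Sort.InsertionSort as InsertionSort
import Data.List.Sort.InsertionSort.Properties as InsertionSortProperties
open import Data.Maybe.Base as Maybe using (Maybe)
open import Data.Nat.Base as ℕ using (ℕ; zero; suc; z≤n; s≤s)
open import Data.Nat.Coprimality using (1-coprimeTo)
open import Data.Nat.Induction using (<-rec)
open import Data.Nat.ListAction.Properties using (sum-↭)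
import Data.Nat.Properties as ℕₚ
open import Data.Product.Base using (Σ-syntax; _,_; proj₁; proj₂)
open import Data.Rational.Base as ℚ using (ℚ; mkℚ; 0ℚ; 1ℚ)
import Data.Rational.Properties as ℚₚ
import Data.Rational.Unnormalised.Base as ℚᵘ
open import Data.Sum.Base using (inj₂)
open import Data.Vec.Functional using (Vector; tail)
open import Function.Base using (_∘_)
open import Function.Bundles using (Equivalence)
open import Level using (Level; _⊔_) renaming (suc to lsuc)
import Relation.Binary.Construct.Flip.EqAndOrd as Flip
open import Relation.Binary.PropositionalEquality.Core as ≡ using (_≡_; _≢_)
import Relation.Binary.Reasoning.Setoid as SetoidReasoning
open import Relation.Nullary.Decidable using (dec⇒maybe; yes; no)
open import Relation.Nullary.Negation using (contradiction)

open InsertionSort (Flip.decTotalOrder ℕₚ.≤-decTotalOrder) using (insert)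
open InsertionSortProperties (Flip.decTotalOrder ℕₚ.≤-decTotalOrder) using (insert-↭; insert-↗)

-- Adding a part to a partition.

insertPart : ℕ → Partition → Partition
insertPart r (mkPartition xs dec pos) = mkPartition (insert (suc r) xs) (insert-↗ (suc r) dec)
  (All-resp-↭ (↭-sym (insert-↭ (suc r) xs)) (s≤s z≤n ∷ pos))

∣insertPart∣ : ∀ r ν → ∣ insertPart r ν ∣ ≡ suc r ℕ.+ ∣ ν ∣
∣insertPart∣ r ν = sum-↭ (insert-↭ (suc r) (parts ν))

module Reals {c ℓ₁ ℓ₂} (R : RealNumbers c ℓ₁ ℓ₂) where

  open RealNotation R public
  module ℝ = CommutativeRing commutativeRing
  open RingProperties ℝ.ring
    using (-‿distribˡ-*; -‿distribʳ-*; -‿involutive; -0#≈0#)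
  open AbelianGroupProperties ℝ.+-abelianGroup using (⁻¹-∙-comm)
  open SemiringMult ℝ.semiring using (×-homo-+; ×1-homo-*)
  open SemiringSum ℝ.semiring using (*-distribˡ-sum)
  open CommutativeMonoidSum ℝ.+-commutativeMonoid using (∑-distrib-+; sum-cong-≋)
  open SetoidReasoning ℝ.setoid public

  -- The integers in ℝ, and the ring solver with integer coefficients

  fromℤ-neg : ∀ i → fromℤ (ℤ.- i) ≈ - fromℤ i
  fromℤ-neg (ℤ.+ zero)    = sym -0#≈0#
  fromℤ-neg (ℤ.+ (suc n)) = refl
  fromℤ-neg ℤ.-[1+ n ]    = sym (-‿involutive _)

  fromℤ-⊖ : ∀ m n → fromℤ (m ℤ.⊖ n) ≈ m · 1# - n · 1#
  fromℤ-⊖ zero    zero    = sym (-‿inverseʳ 0#)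
  fromℤ-⊖ zero    (suc n) = sym (+-identityˡ _)
  fromℤ-⊖ (suc m) zero    = sym (trans (+-congˡ -0#≈0#) (+-identityʳ _))
  fromℤ-⊖ (suc m) (suc n) = begin
    fromℤ (suc m ℤ.⊖ suc n)             ≡⟨ ≡.cong fromℤ (ℤₚ.[1+m]⊖[1+n]≡m⊖n m n) ⟩
    fromℤ (m ℤ.⊖ n)                     ≈⟨ fromℤ-⊖ m n ⟩
    m · 1# - n · 1#                     ≈⟨ +-congʳ (trans (+-congʳ (-‿inverseʳ 1#)) (+-identityˡ _)) ⟨
    ((1# - 1#) + m · 1#) - n · 1#       ≈⟨ +-congʳ (trans (+-assoc _ _ _) (trans (+-congˡ (+-comm _ _)) (sym (+-assoc _ _ _)))) ⟩
    ((1# + m · 1#) - 1#) - n · 1#       ≈⟨ +-assoc _ _ _ ⟩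
    (1# + m · 1#) + (- 1# - n · 1#)     ≈⟨ +-congˡ (⁻¹-∙-comm 1# (n · 1#)) ⟩
    suc m · 1# - suc n · 1#             ∎

  fromℤ-+ : ∀ i j → fromℤ (i ℤ.+ j) ≈ fromℤ i + fromℤ j
  fromℤ-+ (ℤ.+ m)    (ℤ.+ n)    = ×-homo-+ 1# m n
  fromℤ-+ (ℤ.+ m)    ℤ.-[1+ n ] = fromℤ-⊖ m (suc n)
  fromℤ-+ ℤ.-[1+ m ] (ℤ.+ n)    = trans (fromℤ-⊖ n (suc m)) (+-comm _ _)
  fromℤ-+ ℤ.-[1+ m ] ℤ.-[1+ n ] = begin
    - (suc (suc (m ℕ.+ n)) · 1#)    ≡⟨ ≡.cong (λ k → - (k · 1#)) (≡.cong suc (ℕₚ.+-suc m n)) ⟨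
    - ((suc m ℕ.+ suc n) · 1#)      ≈⟨ -‿cong (×-homo-+ 1# (suc m) (suc n)) ⟩
    - (suc m · 1# + suc n · 1#)     ≈⟨ ⁻¹-∙-comm _ _ ⟨
    - (suc m · 1#) - suc n · 1#     ∎

  fromℤ-pos-* : ∀ m j → fromℤ (ℤ.+ m ℤ.* j) ≈ (m · 1#) * fromℤ j
  fromℤ-pos-* m (ℤ.+ n) =
    trans (reflexive (≡.cong fromℤ (≡.sym (ℤₚ.pos-* m n)))) (×1-homo-* m n)
  fromℤ-pos-* m ℤ.-[1+ n ] = begin
    fromℤ (ℤ.+ m ℤ.* ℤ.-[1+ n ])       ≡⟨ ≡.cong fromℤ (ℤₚ.neg-distribʳ-* (ℤ.+ m) (ℤ.+ suc n)) ⟨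
    fromℤ (ℤ.- (ℤ.+ m ℤ.* ℤ.+ suc n))  ≈⟨ fromℤ-neg (ℤ.+ m ℤ.* ℤ.+ suc n) ⟩
    - fromℤ (ℤ.+ m ℤ.* ℤ.+ suc n)      ≈⟨ -‿cong (fromℤ-pos-* m (ℤ.+ suc n)) ⟩
    - ((m · 1#) * (suc n · 1#))        ≈⟨ -‿distribʳ-* _ _ ⟩
    (m · 1#) * - (suc n · 1#)          ∎

  fromℤ-* : ∀ i j → fromℤ (i ℤ.* j) ≈ fromℤ i * fromℤ j
  fromℤ-* (ℤ.+ m)    j = fromℤ-pos-* m j
  fromℤ-* ℤ.-[1+ m ] j = begin
    fromℤ (ℤ.-[1+ m ] ℤ.* j)       ≡⟨ ≡.cong fromℤ (ℤₚ.neg-distribˡ-* (ℤ.+ suc m) j) ⟨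
    fromℤ (ℤ.- (ℤ.+ suc m ℤ.* j))  ≈⟨ fromℤ-neg (ℤ.+ suc m ℤ.* j) ⟩
    - fromℤ (ℤ.+ suc m ℤ.* j)      ≈⟨ -‿cong (fromℤ-pos-* (suc m) j) ⟩
    - ((suc m · 1#) * fromℤ j)     ≈⟨ -‿distribˡ-* _ _ ⟩
    - (suc m · 1#) * fromℤ j       ∎

  fromℤ-morphism : ℤ.+-*-rawRing -Raw-AlmostCommutative⟶ fromCommutativeRing commutativeRing
  fromℤ-morphism = record
    { ⟦_⟧    = fromℤ
    ; +-homo = fromℤ-+
    ; *-homo = fromℤ-*
    ; -‿homo = fromℤ-neg
    ; 0-homo = refl
    ; 1-homo = +-identityʳ 1#
    }

  fromℤ-≟ : ∀ i j → Maybe (fromℤ i ≈ fromℤ j)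
  fromℤ-≟ i j = Maybe.map (reflexive ∘ ≡.cong fromℤ) (dec⇒maybe (i ℤₚ.≟ j))

  open RingSolver ℤ.+-*-rawRing (fromCommutativeRing commutativeRing) fromℤ-morphism fromℤ-≟
    using (solve; _:=_; _:+_; _:*_; _:-_)

  x*yz≈y*xz : ∀ x y z → x * (y * z) ≈ y * (x * z)
  x*yz≈y*xz = solve 3 (λ x y z → x :* (y :* z) := y :* (x :* z)) refl

  x-y≈0⇒x≈y : ∀ {x y} → x - y ≈ 0# → x ≈ y
  x-y≈0⇒x≈y {x} {y} x-y≈0 = begin
    x          ≈⟨ solve 2 (λ x y → x := (x :- y) :+ y) refl x y ⟩
    x - y + y  ≈⟨ +-congʳ x-y≈0 ⟩
    0# + y     ≈⟨ +-identityˡ y ⟩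
    y          ∎

  -- The rationals in ℝ

  unit-cancel : ∀ {u v x y} → v * u ≈ 1# → u * x ≈ u * y → x ≈ y
  unit-cancel {u} {v} {x} {y} vu≈1 ux≈uy = begin
    x            ≈⟨ *-identityˡ x ⟨
    1# * x       ≈⟨ *-congʳ vu≈1 ⟨
    v * u * x    ≈⟨ *-assoc v u x ⟩
    v * (u * x)  ≈⟨ *-congˡ ux≈uy ⟩
    v * (u * y)  ≈⟨ *-assoc v u y ⟨
    v * u * y    ≈⟨ *-congʳ vu≈1 ⟩
    1# * y       ≈⟨ *-identityˡ y ⟩
    y            ∎

  -- #⇒invertible inverts y - 0# rather than y.
  reciprocal : ∀ {y} (y#0 : y # 0#) → proj₁ (#⇒invertible y#0) * y ≈ 1#
  reciprocal {y} y#0 = trans (*-congˡ (sym (trans (+-congˡ -0#≈0#) (+-identityʳ y))))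
                             (proj₁ (proj₂ (#⇒invertible y#0)))

  suc·1#0 : ∀ n → suc n · 1# # 0#
  suc·1#0 n = Equivalence.from #⇔<⊎> (inj₂ (0<suc·1 n))

  -- This equation determines `fromℚ p` without naming an inverse, so sums and products of rationals
  -- can be treated by clearing denominators.
  ↧*fromℚ≈↥ : ∀ p → fromℤ (ℚ.↧ p) * fromℚ p ≈ fromℤ (ℚ.↥ p)
  ↧*fromℚ≈↥ (mkℚ n d _) = begin
    D * (N * D⁻¹)  ≈⟨ solve 3 (λ D N I → D :* (N :* I) := N :* (I :* D)) refl D N D⁻¹ ⟩
    N * (D⁻¹ * D)  ≈⟨ *-congˡ (reciprocal (suc·1#0 d)) ⟩
    N * 1#         ≈⟨ *-identityʳ N ⟩
    N              ∎
    where
    N = fromℤ n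
    D = suc d · 1#
    D⁻¹ = proj₁ (#⇒invertible (suc·1#0 d))

  ↧-cancel : ∀ u {x y} → fromℤ (ℚᵘ.↧ u) * x ≈ fromℤ (ℚᵘ.↧ u) * y → x ≈ y
  ↧-cancel (ℚᵘ.mkℚᵘ _ d) = unit-cancel (reciprocal (suc·1#0 d))

  -- Cross-multiplication, then cancellation of both denominators. Since `u` may be any unreduced
  -- fraction equal to `p`, the reduction to lowest terms in rational arithmetic never has to be
  -- followed.
  fromℚ-unique : ∀ p {u x} → ℚ.toℚᵘ p ℚᵘ.≃ u → fromℤ (ℚᵘ.↧ u) * x ≈ fromℤ (ℚᵘ.↥ u) → fromℚ p ≈ x
  fromℚ-unique p@record{} {u} {x} (ℚᵘ.*≡* eq) Dx≈N = ↧-cancel u (↧-cancel (ℚ.toℚᵘ p) (begin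
    d * (D * fromℚ p)             ≈⟨ solve 3 (λ d D x → d :* (D :* x) := (d :* x) :* D) refl d D (fromℚ p) ⟩
    (d * fromℚ p) * D             ≈⟨ *-congʳ (↧*fromℚ≈↥ p) ⟩
    fromℤ (ℚ.↥ p) * D             ≈⟨ fromℤ-* (ℚ.↥ p) (ℚᵘ.↧ u) ⟨
    fromℤ (ℚ.↥ p ℤ.* ℚᵘ.↧ u)      ≡⟨ ≡.cong fromℤ eq ⟩
    fromℤ (ℚᵘ.↥ u ℤ.* ℚ.↧ p)      ≈⟨ fromℤ-* (ℚᵘ.↥ u) (ℚ.↧ p) ⟩
    fromℤ (ℚᵘ.↥ u) * d            ≈⟨ *-congʳ Dx≈N ⟨
    (D * x) * d                   ≈⟨ *-comm _ _ ⟩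
    d * (D * x)                   ∎))
    where
    d = fromℤ (ℚ.↧ p)
    D = fromℤ (ℚᵘ.↧ u)

  fromℚ-* : ∀ p q → fromℚ (p ℚ.* q) ≈ fromℚ p * fromℚ q
  fromℚ-* p@record{} q@record{} = fromℚ-unique (p ℚ.* q) (ℚₚ.toℚᵘ-homo-* p q) (begin
    fromℤ (ℤ.+ (ℚ.↧ₙ p ℕ.* ℚ.↧ₙ q)) * (x * y)  ≈⟨ *-congʳ (×1-homo-* (ℚ.↧ₙ p) (ℚ.↧ₙ q)) ⟩
    (d * e) * (x * y)                ≈⟨ solve 4 (λ d e x y → (d :* e) :* (x :* y) := (d :* x) :* (e :* y)) refl d e x y ⟩
    (d * x) * (e * y)                ≈⟨ *-cong (↧*fromℚ≈↥ p) (↧*fromℚ≈↥ q) ⟩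
    fromℤ (ℚ.↥ p) * fromℤ (ℚ.↥ q)    ≈⟨ fromℤ-* (ℚ.↥ p) (ℚ.↥ q) ⟨
    fromℤ (ℚ.↥ p ℤ.* ℚ.↥ q)          ∎)
    where
    d = fromℤ (ℚ.↧ p)
    e = fromℤ (ℚ.↧ q)
    x = fromℚ p
    y = fromℚ q

  fromℚ-+ : ∀ p q → fromℚ (p ℚ.+ q) ≈ fromℚ p + fromℚ q
  fromℚ-+ p@record{} q@record{} = fromℚ-unique (p ℚ.+ q) (ℚₚ.toℚᵘ-homo-+ p q) (begin
    fromℤ (ℤ.+ (ℚ.↧ₙ p ℕ.* ℚ.↧ₙ q)) * (x + y)  ≈⟨ *-congʳ (×1-homo-* (ℚ.↧ₙ p) (ℚ.↧ₙ q)) ⟩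
    (d * e) * (x + y)                ≈⟨ solve 4 (λ d e x y → (d :* e) :* (x :+ y) := (d :* x) :* e :+ (e :* y) :* d) refl d e x y ⟩
    (d * x) * e + (e * y) * d        ≈⟨ +-cong (*-congʳ (↧*fromℚ≈↥ p)) (*-congʳ (↧*fromℚ≈↥ q)) ⟩
    fromℤ (ℚ.↥ p) * e + fromℤ (ℚ.↥ q) * d
      ≈⟨ +-cong (fromℤ-* (ℚ.↥ p) (ℚ.↧ q)) (fromℤ-* (ℚ.↥ q) (ℚ.↧ p)) ⟨
    fromℤ (ℚ.↥ p ℤ.* ℚ.↧ q) + fromℤ (ℚ.↥ q ℤ.* ℚ.↧ p)
      ≈⟨ fromℤ-+ (ℚ.↥ p ℤ.* ℚ.↧ q) (ℚ.↥ q ℤ.* ℚ.↧ p) ⟨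
    fromℤ (ℚ.↥ p ℤ.* ℚ.↧ q ℤ.+ ℚ.↥ q ℤ.* ℚ.↧ p)  ∎)
    where
    d = fromℤ (ℚ.↧ p)
    e = fromℤ (ℚ.↧ q)
    x = fromℚ p
    y = fromℚ q

  fromℚ-0 : fromℚ 0ℚ ≈ 0#
  fromℚ-0 = zeroˡ _

  fromℚ-1 : fromℚ 1ℚ ≈ 1#
  fromℚ-1 = fromℚ-unique 1ℚ (ℚᵘ.*≡* {q = ℚᵘ.1ℚᵘ} ≡.refl) (*-identityʳ _)

  -- Power series, given by their coefficients

  -- The coefficient of zⁿ in the product of the series `p` and `h`; the recursion takes off the
  -- constant term of `p` and shifts the rest.
  conv : (ℕ → ℝ) → (ℕ → ℝ) → ℕ → ℝ
  conv p h zero    = p 0 * h 0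
  conv p h (suc n) = p 0 * h (suc n) + conv (p ∘ suc) h n

  conv-cong : ∀ {p p′ h h′} → (∀ n → p n ≈ p′ n) → (∀ n → h n ≈ h′ n) →
              ∀ n → conv p h n ≈ conv p′ h′ n
  conv-cong p≈ h≈ zero    = *-cong (p≈ 0) (h≈ 0)
  conv-cong p≈ h≈ (suc n) = +-cong (*-cong (p≈ 0) (h≈ (suc n))) (conv-cong (p≈ ∘ suc) h≈ n)

  conv-zeroˡ : ∀ {p h} → (∀ n → p n ≈ 0#) → ∀ n → conv p h n ≈ 0#
  conv-zeroˡ p≈0 zero    = trans (*-congʳ (p≈0 0)) (zeroˡ _)
  conv-zeroˡ p≈0 (suc n) =
    trans (+-cong (trans (*-congʳ (p≈0 0)) (zeroˡ _)) (conv-zeroˡ (p≈0 ∘ suc) n)) (+-identityˡ 0#)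

  conv-subˡ : ∀ p r h n → conv (λ i → p i - r i) h n ≈ conv p h n - conv r h n
  conv-subˡ p r h zero    = solve 3 (λ p r h → (p :- r) :* h := p :* h :- r :* h) refl (p 0) (r 0) (h 0)
  conv-subˡ p r h (suc n) = trans (+-congˡ (conv-subˡ (p ∘ suc) (r ∘ suc) h n))
    (solve 5 (λ p r h x y → (p :- r) :* h :+ (x :- y) := (p :* h :+ x) :- (r :* h :+ y))
      refl (p 0) (r 0) (h (suc n)) (conv (p ∘ suc) h n) (conv (r ∘ suc) h n))

  conv-scaleˡ : ∀ x p h n → conv (λ i → x * p i) h n ≈ x * conv p h n
  conv-scaleˡ x p h zero    = *-assoc x (p 0) (h 0)
  conv-scaleˡ x p h (suc n) = trans (+-cong (*-assoc _ _ _) (conv-scaleˡ x (p ∘ suc) h n)) (sym (distribˡ _ _ _))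

  mul[1-_z] : ℝ → (ℕ → ℝ) → ℕ → ℝ
  mul[1- x z] h zero    = h 0
  mul[1- x z] h (suc n) = h (suc n) - x * h n

  mul-≈0 : ∀ x {h} → (∀ n → h n ≈ 0#) → ∀ n → mul[1- x z] h n ≈ 0#
  mul-≈0 x h≈0 zero    = h≈0 0
  mul-≈0 x h≈0 (suc n) = begin
    _ - x * _    ≈⟨ +-cong (h≈0 (suc n)) (-‿cong (*-congˡ (h≈0 n))) ⟩
    0# - x * 0#  ≈⟨ +-congˡ (-‿cong (zeroʳ x)) ⟩
    0# - 0#      ≈⟨ -‿inverseʳ 0# ⟩
    0#           ∎

  -- The series 1 - x z has constant term 1, so it is no zero divisor: the coefficients of `h`
  -- vanish one after another.
  mul-≈0⁻¹ : ∀ x {h} → (∀ n → mul[1- x z] h n ≈ 0#) → ∀ n → h n ≈ 0#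
  mul-≈0⁻¹ x mul≈0 zero    = mul≈0 0
  mul-≈0⁻¹ x {h} mul≈0 (suc n) = begin
    h (suc n)                          ≈⟨ solve 2 (λ u v → u := (u :- v) :+ v) refl (h (suc n)) (x * h n) ⟩
    h (suc n) - x * h n + x * h n      ≈⟨ +-cong (mul≈0 (suc n)) (*-congˡ (mul-≈0⁻¹ x mul≈0 n)) ⟩
    0# + x * 0#                        ≈⟨ trans (+-identityˡ _) (zeroʳ x) ⟩
    0#                                 ∎

  -- The series Σ xⁱ⁺¹ zⁱ is x / (1 - x z), and multiplication by 1 - x z cancels its denominator.
  conv-geometric : ∀ x h n → conv (λ i → x ^ suc i) (mul[1- x z] h) n ≈ x * h n
  conv-geometric x h zero    = *-congʳ (*-identityʳ x)
  conv-geometric x h (suc n) = begin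
    x * 1# * (h (suc n) - x * h n) + conv (λ i → x * x ^ suc i) (mul[1- x z] h) n
      ≈⟨ +-cong (*-congʳ (*-identityʳ x)) (trans (conv-scaleˡ x _ _ n) (*-congˡ (conv-geometric x h n))) ⟩
    x * (h (suc n) - x * h n) + x * (x * h n)
      ≈⟨ solve 3 (λ x u v → x :* (u :- x :* v) :+ x :* (x :* v) := x :* u) refl x (h (suc n)) (h n) ⟩
    x * h (suc n) ∎

  conv-mulʳ : ∀ x p h n → conv p (mul[1- x z] h) n ≈ mul[1- x z] (conv p h) n
  conv-mulʳ x p h zero = refl
  -- `mul[1- x z]` has no shifted term at index 0, so index 1 cannot share the recursive clause.
  conv-mulʳ x p h (suc zero) =
    solve 5 (λ x p₀ p₁ h₀ h₁ → p₀ :* (h₁ :- x :* h₀) :+ p₁ :* h₀ := (p₀ :* h₁ :+ p₁ :* h₀) :- x :* (p₀ :* h₀))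
      refl x (p 0) (p 1) (h 0) (h 1)
  conv-mulʳ x p h (suc (suc n)) = trans (+-congˡ (conv-mulʳ x (p ∘ suc) h (suc n)))
    (solve 6 (λ x p₀ h₁ h₂ u v → p₀ :* (h₂ :- x :* h₁) :+ (u :- x :* v) := (p₀ :* h₂ :+ u) :- x :* (p₀ :* h₁ :+ v))
      refl x (p 0) (h (suc n)) (h (suc (suc n))) (conv (p ∘ suc) h (suc n)) (conv (p ∘ suc) h n))

  -- The coefficient of zⁿ in h′ - p h.
  newtonDefect : (ℕ → ℝ) → (ℕ → ℝ) → ℕ → ℝ
  newtonDefect p h n = suc n · 1# * h (suc n) - conv p h n

  newtonDefect-cong : ∀ {p p′ h h′} → (∀ n → p n ≈ p′ n) → (∀ n → h n ≈ h′ n) →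
                      ∀ n → newtonDefect p h n ≈ newtonDefect p′ h′ n
  newtonDefect-cong p≈ h≈ n = +-cong (*-congˡ (h≈ (suc n))) (-‿cong (conv-cong p≈ h≈ n))

  -- The logarithmic derivative of 1 - x z is - Σ xʳ⁺¹ zʳ.
  newtonDefect-mul : ∀ x p h n →
    newtonDefect (λ r → p r - x ^ suc r) (mul[1- x z] h) n ≈ mul[1- x z] (newtonDefect p h) n
  newtonDefect-mul x p h n = trans (+-congˡ (-‿cong (begin
      conv (λ r → p r - x ^ suc r) (mul[1- x z] h) n
        ≈⟨ conv-subˡ p _ _ n ⟩
      conv p (mul[1- x z] h) n - conv (λ r → x ^ suc r) (mul[1- x z] h) n
        ≈⟨ +-cong (conv-mulʳ x p h n) (-‿cong (conv-geometric x h n)) ⟩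
      mul[1- x z] (conv p h) n - x * h n ∎))) (collect n)
    where
    -- Product rule: differentiating 1 - x z leaves a term - x h, which cancels the x h from the
    -- geometric series, so the common factor 1 - x z comes out.
    collect : ∀ n → suc n · 1# * mul[1- x z] h (suc n) - (mul[1- x z] (conv p h) n - x * h n)
                    ≈ mul[1- x z] (newtonDefect p h) n
    collect zero = trans (+-congʳ (*-congʳ (+-identityʳ 1#))) (trans (+-congʳ (*-identityˡ _)) (trans
      (solve 4 (λ x h₀ h₁ p → (h₁ :- x :* h₀) :- (p :- x :* h₀) := h₁ :- p) refl x (h 0) (h 1) (conv p h 0))
      (+-congʳ (sym (trans (*-congʳ (+-identityʳ 1#)) (*-identityˡ _))))))
    collect (suc n) = begin
      (1# + N) * (h₂ - x * h₁) - ((u - x * v) - x * h₁)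
        ≈⟨ +-congʳ (trans (distribʳ _ _ _) (+-congʳ (*-identityˡ _))) ⟩
      (h₂ - x * h₁) + N * (h₂ - x * h₁) - ((u - x * v) - x * h₁)
        ≈⟨ solve 6 (λ N x h₁ h₂ u v → (h₂ :- x :* h₁) :+ N :* (h₂ :- x :* h₁) :- ((u :- x :* v) :- x :* h₁)
                                      := (h₂ :+ N :* h₂ :- u) :- x :* (N :* h₁ :- v)) refl N x h₁ h₂ u v ⟩
      (h₂ + N * h₂ - u) - x * (N * h₁ - v)
        ≈⟨ +-congʳ (+-congʳ (trans (distribʳ _ _ _) (+-congʳ (*-identityˡ _)))) ⟨
      ((1# + N) * h₂ - u) - x * (N * h₁ - v) ∎
      where
      N  = suc n · 1#
      h₁ = h (suc n)
      h₂ = h (suc (suc n))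
      u  = conv p h (suc n)
      v  = conv p h n

  -- Lagrange interpolation

  sum-linear : ∀ x {n} (f g : Vector ℝ n) → sum (λ i → f i + x * g i) ≈ sum f + x * sum g
  sum-linear x f g = trans (∑-distrib-+ f (λ i → x * g i)) (+-congˡ (sym (*-distribˡ-sum x g)))

  sum-sublinear : ∀ x {n} (f g : Vector ℝ n) → sum (λ i → f i - x * g i) ≈ sum f - x * sum g
  sum-sublinear x f g = begin
    sum (λ i → f i - x * g i)      ≈⟨ sum-cong-≋ (λ i → +-congˡ (-‿distribˡ-* x (g i))) ⟩
    sum (λ i → f i + - x * g i)    ≈⟨ sum-linear (- x) f g ⟩
    sum f + - x * sum g            ≈⟨ +-congˡ (-‿distribˡ-* x (sum g)) ⟨
    sum f - x * sum g              ∎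

  -- An equation rather than a division, so that the weights left after deleting a point can be
  -- written down without new proofs of apartness.
  InvertsDenominator : ∀ {m} → Vector ℝ (suc m) → Vector ℝ (suc m) → Set ℓ₁
  InvertsDenominator a w = ∀ i → w i * denominator a i ≈ 1#

  -- Multiplying the weight by aᵢ - a₀ cancels the factor of the denominator that belongs to the
  -- deleted point.
  remove₀ : ∀ {m} {a w : Vector ℝ (suc (suc m))} → InvertsDenominator a w →
            InvertsDenominator (tail a) (λ i → (a (fsuc i) - a fzero) * w (fsuc i))
  remove₀ {a = a} {w} inv i = trans
    (solve 3 (λ d w x → (d :* w) :* x := w :* (d :* x)) refl (a (fsuc i) - a fzero) (w (fsuc i)) _)
    (inv (fsuc i))

  remove₁ : ∀ {m} {a w : Vector ℝ (suc (suc m))} → InvertsDenominator a w →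
            let p = punchIn (fsuc fzero) in
            InvertsDenominator (a ∘ p) (λ i → (a (p i) - a (fsuc fzero)) * w (p i))
  remove₁ {a = a} {w} inv fzero = trans
    (solve 3 (λ d w x → (d :* w) :* x := w :* (d :* x)) refl (a fzero - a (fsuc fzero)) (w fzero) _)
    (inv fzero)
  -- Here a₀ comes before a₁ in the denominator, so the factor to cancel is the second one, not the
  -- first.
  remove₁ {m = suc m} {a} {w} inv (fsuc i) = trans
    (solve 4 (λ d e w x → (d :* w) :* (e :* x) := w :* (e :* (d :* x))) refl
       (a (fsuc (fsuc i)) - a (fsuc fzero)) (a (fsuc (fsuc i)) - a fzero) (w (fsuc (fsuc i))) _)
    (inv (fsuc (fsuc i)))

  δ : ℕ → ℕ → ℝ
  δ zero    zero    = 1#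
  δ zero    (suc _) = 0#
  δ (suc _) zero    = 0#
  δ (suc m) (suc n) = δ m n

  δ-≢ : ∀ {m n} → m ≢ n → δ m n ≈ 0#
  δ-≢ {zero}  {zero}  m≢n = contradiction ≡.refl m≢n
  δ-≢ {zero}  {suc n} m≢n = refl
  δ-≢ {suc m} {zero}  m≢n = refl
  δ-≢ {suc m} {suc n} m≢n = δ-≢ (m≢n ∘ ≡.cong suc)

  -- Deleting a₀ or a₁ gives the same value, while the two resulting sums
  -- differ by (a₀ - a₁) times the given one.
  sum-weights : ∀ {m} {a w : Vector ℝ (suc m)} → InvertsDenominator a w → sum w ≈ δ m 0
  sum-weights {zero}          inv = trans (+-identityʳ _) (trans (sym (*-identityʳ _)) (inv fzero))
  sum-weights {suc m} {a} {w} inv = unit-cancel unit (begin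
    (a₀ - a₁) * (w₀ + (w₁ + W))
      ≈⟨ solve 6 (λ a₀ a₁ w₀ w₁ W A → (a₀ :- a₁) :* (w₀ :+ (w₁ :+ W))
           := ((a₀ :- a₁) :* w₀ :+ (A :- a₁ :* W)) :- ((a₁ :- a₀) :* w₁ :+ (A :- a₀ :* W)))
         refl a₀ a₁ w₀ w₁ W A ⟩
    ((a₀ - a₁) * w₀ + (A - a₁ * W)) - ((a₁ - a₀) * w₁ + (A - a₀ * W))
      ≈⟨ +-cong (+-congˡ (rest a₁)) (-‿cong (+-congˡ (rest a₀))) ⟨
    sum (λ i → (a (p i) - a₁) * w (p i)) - sum (λ i → (a (fsuc i) - a₀) * w (fsuc i))
      -- Both sums are `δ m 0`, whether this is 0 or, for `m = 0`, 1; only their difference matters.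
      ≈⟨ +-cong (sum-weights (remove₁ inv)) (-‿cong (sum-weights (remove₀ inv))) ⟩
    δ m 0 - δ m 0
      ≈⟨ -‿inverseʳ _ ⟩
    0#
      ≈⟨ zeroʳ _ ⟨
    (a₀ - a₁) * 0# ∎)
    where
    p  = punchIn (fsuc fzero)
    a₀ = a fzero
    a₁ = a (fsuc fzero)
    w₀ = w fzero
    w₁ = w (fsuc fzero)
    W  = sum (tail (tail w))
    A  = sum (λ i → a (fsuc (fsuc i)) * w (fsuc (fsuc i)))
    rest : ∀ x → sum (λ i → (a (fsuc (fsuc i)) - x) * w (fsuc (fsuc i))) ≈ A - x * W
    rest x = trans
      (sum-cong-≋ (λ i → solve 3 (λ a x w → (a :- x) :* w := a :* w :- x :* w) refl (a (fsuc (fsuc i))) x (w (fsuc (fsuc i)))))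
      (sum-sublinear x (λ i → a (fsuc (fsuc i)) * w (fsuc (fsuc i))) (tail (tail w)))
    r = product (λ j → a₀ - a (fsuc (fsuc j)))
    -- a₀ - a₁ is a factor of the first denominator, so the weight `w₀` supplies its inverse.
    unit : (w₀ * r) * (a₀ - a₁) ≈ 1#
    unit = trans (solve 3 (λ w r d → (w :* r) :* d := w :* (d :* r)) refl w₀ r (a₀ - a₁)) (inv fzero)

  rootProduct : ∀ {n} → Vector ℝ n → ℝ → ℝ
  rootProduct b x = product (λ j → x - b j)

  -- Both sides are the coefficient of xᵐ in the polynomial that interpolates
  -- rootProduct b at the points a.
  sum-rootProduct : ∀ {m n} → n ℕ.≤ m → {a w : Vector ℝ (suc m)} (b : Vector ℝ n) →
    InvertsDenominator a w → sum (λ i → rootProduct b (a i) * w i) ≈ δ m n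
  sum-rootProduct {m} {zero} z≤n {w = w} b inv =
    trans (sum-cong-≋ (λ i → *-identityˡ (w i))) (sum-weights inv)
  sum-rootProduct {suc m} {suc n} (s≤s n≤m) {a} {w} b inv = begin
    sum (λ i → ((a i - b₀) * P (a i)) * w i)
      -- Here x - b₀ is split as (x - a₀) + (a₀ - b₀): the first part deletes the point a₀ together
      -- with the root b₀, the second keeps all points but has too low a degree to contribute.
      ≈⟨ sum-cong-≋ (λ i → solve 5 (λ a b P w a₀ → ((a :- b) :* P) :* w := P :* ((a :- a₀) :* w) :+ (a₀ :- b) :* (P :* w))
           refl (a i) b₀ (P (a i)) (w i) a₀) ⟩
    sum (λ i → P (a i) * ((a i - a₀) * w i) + (a₀ - b₀) * (P (a i) * w i))
      ≈⟨ sum-linear (a₀ - b₀) (λ i → P (a i) * ((a i - a₀) * w i)) (λ i → P (a i) * w i) ⟩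
    sum (λ i → P (a i) * ((a i - a₀) * w i)) + (a₀ - b₀) * sum (λ i → P (a i) * w i)
      ≈⟨ +-cong
           (+-cong (trans (*-congˡ (trans (*-congʳ (-‿inverseʳ a₀)) (zeroˡ _))) (zeroʳ _))
                   (sum-rootProduct n≤m (tail b) (remove₀ inv)))
           (*-congˡ (trans (sum-rootProduct (ℕₚ.m≤n⇒m≤1+n n≤m) (tail b) inv)
                           (δ-≢ (ℕₚ.>⇒≢ (s≤s n≤m))))) ⟩
    (0# + δ m n) + (a₀ - b₀) * 0#
      ≈⟨ +-cong (+-identityˡ _) (zeroʳ _) ⟩
    δ m n + 0#
      ≈⟨ +-identityʳ _ ⟩
    δ m n ∎
    where
    a₀ = a fzero
    b₀ = b fzero
    P  = rootProduct (tail b)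

  -- Newton's identities for the sums on the left-hand side.

  δ-refl : ∀ n → δ n n ≈ 1#
  δ-refl zero    = refl
  δ-refl (suc n) = δ-refl n

  -- With inverse denominators as weights `w`, this is by definition the left-hand side of the
  -- theorem, division there being multiplication by the chosen inverse.
  moment : ∀ {m} → Vector ℝ (suc m) → Vector ℝ (suc m) → Vector ℝ m → ℕ → ℝ
  moment a w b k = sum (λ i → rootProduct b (a i) * w i * a i ^ k)

  moment-zero : ∀ {m} {a w : Vector ℝ (suc m)} (b : Vector ℝ m) →
                InvertsDenominator a w → moment a w b 0 ≈ 1#
  moment-zero {m} {a} {w} b inv =
    trans (sum-cong-≋ (λ i → *-identityʳ (rootProduct b (a i) * w i))) (trans (sum-rootProduct ℕₚ.≤-refl b inv) (δ-refl m))

  -- The factor 1 - a₀ z puts aᵢ - a₀ into each term, which kills the term of a₀ and adjusts the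
  -- other weights; the factor aᵢ - b₀ of the root product is then read as multiplication by 1 - b₀
  -- z.
  moment-remove : ∀ {m} {a w : Vector ℝ (suc (suc m))} (b : Vector ℝ (suc m)) →
    InvertsDenominator a w →
    ∀ k → mul[1- a fzero z] (moment a w b) k
          ≈ mul[1- b fzero z] (moment (tail a) (λ i → (a (fsuc i) - a fzero) * w (fsuc i)) (tail b)) k
  -- Constant terms: both moments of order 0 are 1.
  moment-remove b inv zero = trans (moment-zero b inv) (sym (moment-zero (tail b) (remove₀ inv)))
  moment-remove {a = a} {w} b inv (suc k) = begin
    sum (λ i → f i * (a i * a i ^ k)) - a₀ * sum (λ i → f i * a i ^ k)
      ≈⟨ sum-sublinear a₀ (λ i → f i * (a i * a i ^ k)) (λ i → f i * a i ^ k) ⟨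
    (f fzero * (a₀ * a₀ ^ k) - a₀ * (f fzero * a₀ ^ k))
      + sum (λ i → f (fsuc i) * (a (fsuc i) * a (fsuc i) ^ k) - a₀ * (f (fsuc i) * a (fsuc i) ^ k))
      ≈⟨ +-cong
           (trans (+-congʳ (solve 3 (λ f a e → f :* (a :* e) := a :* (f :* e)) refl (f fzero) a₀ (a₀ ^ k))) (-‿inverseʳ _))
           (sum-cong-≋ λ i → solve 6 (λ a b P w e a₀ →
                ((a :- b) :* P) :* w :* (a :* e) :- a₀ :* (((a :- b) :* P) :* w :* e)
                := P :* ((a :- a₀) :* w) :* (a :* e) :- b :* (P :* ((a :- a₀) :* w) :* e))
              refl (a (fsuc i)) b₀ (rootProduct (tail b) (a (fsuc i))) (w (fsuc i)) (a (fsuc i) ^ k) a₀) ⟩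
    0# + sum (λ i → g i * (a (fsuc i) * a (fsuc i) ^ k) - b₀ * (g i * a (fsuc i) ^ k))
      ≈⟨ +-identityˡ _ ⟩
    sum (λ i → g i * (a (fsuc i) * a (fsuc i) ^ k) - b₀ * (g i * a (fsuc i) ^ k))
      ≈⟨ sum-sublinear b₀ (λ i → g i * (a (fsuc i) * a (fsuc i) ^ k)) (λ i → g i * a (fsuc i) ^ k) ⟩
    sum (λ i → g i * (a (fsuc i) * a (fsuc i) ^ k)) - b₀ * sum (λ i → g i * a (fsuc i) ^ k) ∎
    where
    a₀ = a fzero
    b₀ = b fzero
    f : Vector ℝ _
    f i = rootProduct b (a i) * w i
    g : Vector ℝ _
    g i = rootProduct (tail b) (a (fsuc i)) * ((a (fsuc i) - a₀) * w (fsuc i))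

  -- The identity for the points without a₀ and b₀, multiplied by 1 - b₀ z, becomes the identity for
  -- all points multiplied by 1 - a₀ z: taking the power of a₀ from the full power difference leaves
  -- the same as taking the power of b₀ from the shortened one.
  moment-newton : ∀ {m} {a w : Vector ℝ (suc m)} (b : Vector ℝ m) → InvertsDenominator a w →
    ∀ n → newtonDefect (λ r → powerDiff (suc r) a b) (moment a w b) n ≈ 0#
  -- With one point the series is 1 / (1 - a₀ z); times 1 - a₀ z it is the constant 1, and the power
  -- differences left over are 0.
  moment-newton {zero} {a} {w} b inv = mul-≈0⁻¹ a₀ λ n → begin
    mul[1- a₀ z] (newtonDefect (λ r → powerDiff (suc r) a b) (moment a w b)) n
      ≈⟨ newtonDefect-mul a₀ _ _ n ⟨
    suc n · 1# * (moment a w b (suc n) - a₀ * moment a w b n)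
      - conv (λ r → powerDiff (suc r) a b - a₀ ^ suc r) (mul[1- a₀ z] (moment a w b)) n
      ≈⟨ +-cong (trans (*-congˡ (trans (+-cong (moment≈ (suc n)) (-‿cong (*-congˡ (moment≈ n)))) (-‿inverseʳ _))) (zeroʳ _))
                (-‿cong (conv-zeroˡ p≈0 n)) ⟩
    0# - 0#
      ≈⟨ -‿inverseʳ 0# ⟩
    0# ∎
    where
    a₀ = a fzero
    moment≈ : ∀ n → moment a w b n ≈ a₀ ^ n
    moment≈ n = trans (+-identityʳ _) (trans
      (*-congʳ (trans (*-comm _ _) (inv fzero))) (*-identityˡ _))
    p≈0 : ∀ r → powerDiff (suc r) a b - a₀ ^ suc r ≈ 0#
    p≈0 r = trans (+-congʳ (trans (+-cong (+-identityʳ _) -0#≈0#) (+-identityʳ _))) (-‿inverseʳ _)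
  moment-newton {suc m} {a} {w} b inv = mul-≈0⁻¹ a₀ λ n → begin
    mul[1- a₀ z] (newtonDefect (λ r → powerDiff (suc r) a b) (moment a w b)) n
      ≈⟨ newtonDefect-mul a₀ _ _ n ⟨
    newtonDefect (λ r → powerDiff (suc r) a b - a₀ ^ suc r) (mul[1- a₀ z] (moment a w b)) n
      ≈⟨ newtonDefect-cong
           (λ r → solve 4 (λ x y s t → ((x :+ s) :- (y :+ t)) :- x := (s :- t) :- y) refl (a₀ ^ suc r) (b₀ ^ suc r) _ _)
           (moment-remove b inv) n ⟩
    newtonDefect (λ r → powerDiff (suc r) (tail a) (tail b) - b₀ ^ suc r) (mul[1- b₀ z] (moment (tail a) w′ (tail b))) n
      ≈⟨ newtonDefect-mul b₀ _ _ n ⟩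
    mul[1- b₀ z] (newtonDefect (λ r → powerDiff (suc r) (tail a) (tail b)) (moment (tail a) w′ (tail b))) n
      ≈⟨ mul-≈0 b₀ (moment-newton (tail b) (remove₀ inv)) n ⟩
    0# ∎
    where
    a₀ = a fzero
    b₀ = b fzero
    w′ : Vector ℝ (suc m)
    w′ i = (a (fsuc i) - a₀) * w (fsuc i)

  -- Sums over partitions

  sumOver-cong : ∀ {A : Set} (xs : List A) {f g : A → ℝ} → (∀ x → f x ≈ g x) → sumOver xs f ≈ sumOver xs g
  sumOver-cong []       f≈g = refl
  sumOver-cong (x ∷ xs) f≈g = +-cong (f≈g x) (sumOver-cong xs f≈g)

  sumOver-+ : ∀ {A : Set} (xs : List A) (f g : A → ℝ) →
              sumOver xs (λ x → f x + g x) ≈ sumOver xs f + sumOver xs g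
  sumOver-+ []       f g = sym (+-identityˡ 0#)
  sumOver-+ (x ∷ xs) f g = trans (+-congˡ (sumOver-+ xs f g))
    (solve 4 (λ a b s t → (a :+ b) :+ (s :+ t) := (a :+ s) :+ (b :+ t)) refl (f x) (g x) (sumOver xs f) (sumOver xs g))

  sumOver-* : ∀ {A : Set} (xs : List A) y (f : A → ℝ) → sumOver xs (λ x → y * f x) ≈ y * sumOver xs f
  sumOver-* []       y f = sym (zeroʳ y)
  sumOver-* (x ∷ xs) y f = trans (+-congˡ (sumOver-* xs y f)) (sym (distribˡ _ _ _))

  sumOver-≈0 : ∀ {A : Set} (xs : List A) {f : A → ℝ} → (∀ {x} → x ∈ xs → f x ≈ 0#) → sumOver xs f ≈ 0#
  sumOver-≈0 []       f≈0 = refl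
  sumOver-≈0 (x ∷ xs) f≈0 = trans (+-cong (f≈0 (here ≡.refl)) (sumOver-≈0 xs (f≈0 ∘ there))) (+-identityˡ 0#)

  sumOver-single : ∀ {A : Set} {xs : List A} {f : A → ℝ} {y} → Unique xs → y ∈ xs →
                   (∀ x → x ≢ y → f x ≈ 0#) → sumOver xs f ≈ f y
  sumOver-single {xs = _ ∷ xs} (y∉xs ∷ _) (here ≡.refl) f≈0 =
    trans (+-congˡ (sumOver-≈0 xs λ x∈xs → f≈0 _ (λ x≡y → All.lookup y∉xs x∈xs (≡.sym x≡y)))) (+-identityʳ _)
  sumOver-single {xs = x ∷ xs} (x∉xs ∷ uniq) (there y∈xs) f≈0 =
    trans (+-cong (f≈0 x (All.lookup x∉xs y∈xs)) (sumOver-single uniq y∈xs f≈0)) (+-identityˡ _)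

  foldr-*-↭ : ∀ {A : Set} (f : A → ℝ) {xs ys} → xs ↭ ys →
              List.foldr (λ x p → f x * p) 1# xs ≈ List.foldr (λ x p → f x * p) 1# ys
  foldr-*-↭ f ↭.refl        = refl
  foldr-*-↭ f (↭.prep x p)  = *-congˡ (foldr-*-↭ f p)
  foldr-*-↭ f (↭.swap x y p) = trans (*-congˡ (*-congˡ (foldr-*-↭ f p))) (x*yz≈y*xz _ _ _)
  foldr-*-↭ f (↭.trans p r) = trans (foldr-*-↭ f p) (foldr-*-↭ f r)

  -- `q` is a product over the parts, so the place where the new part is inserted is immaterial.
  q-insertPart : ∀ {m} r ν (a : Vector ℝ (suc m)) (b : Vector ℝ m) →
                 q (insertPart r ν) a b ≈ powerDiff (suc r) a b * q ν a b
  q-insertPart r ν a b = foldr-*-↭ (λ i → powerDiff i a b) (insert-↭ (suc r) (parts ν))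

-- Sequences satisfying Newton's identities, expressed in the q_ν.

record NewtonSequence {c ℓ₁ ℓ₂} (R : RealNumbers c ℓ₁ ℓ₂) : Set (c ⊔ ℓ₁) where
  open Reals R
  field
    {size} : ℕ
    a      : Vector ℝ (suc size)
    b      : Vector ℝ size
    h      : ℕ → ℝ
    h-zero : h 0 ≈ 1#
    h-suc  : ∀ n → suc n · 1# * h (suc n) ≈ conv (λ r → powerDiff (suc r) a b) h n

module AtSequence {c ℓ₁ ℓ₂} {R : RealNumbers c ℓ₁ ℓ₂} (s : NewtonSequence R) where
  open Reals R public
  open NewtonSequence s public

module _ {c ℓ₁ ℓ₂ : Level} where

  Quantity : Set (lsuc (c ⊔ ℓ₁ ⊔ ℓ₂))
  Quantity = ∀ R → NewtonSequence {c} {ℓ₁} {ℓ₂} R → RealNumbers.Carrier R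

  combination : ℕ → (Partition → ℚ) → Quantity
  combination d ξ R s = sumOver (partitionsUpTo d) (λ ν → fromℚ (ξ ν) * q ν a b)
    where open AtSequence s

  -- The coefficients are fixed before `R` and `s`, so a single family serves every field of reals,
  -- every number of points and every choice of points.
  record Expressible (d : ℕ) (f : Quantity) : Set (lsuc (c ⊔ ℓ₁ ⊔ ℓ₂)) where
    constructor _,_
    field
      coeff  : Partition → ℚ
      equals : ∀ R s → RealNumbers._≈_ R (f R s) (combination d coeff R s)

  expressible-cong : ∀ {d f g} → (∀ R s → RealNumbers._≈_ R (f R s) (g R s)) →
                     Expressible d f → Expressible d g
  expressible-cong f≈g (ξ , eq) = ξ , λ R s → let open RealNumbers R in trans (sym (f≈g R s)) (eq R s)

  expressible-zero : ∀ {d} → Expressible d (λ R s → RealNumbers.0# R)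
  expressible-zero {d} = (λ _ → 0ℚ) , λ R s → let open Reals R in
    sym (sumOver-≈0 (partitionsUpTo d) (λ _ → trans (*-congʳ fromℚ-0) (zeroˡ _)))

  expressible-+ : ∀ {d f g} → Expressible d f → Expressible d g →
                  Expressible d (λ R s → RealNumbers._+_ R (f R s) (g R s))
  expressible-+ {d} (ξ , f≈) (χ , g≈) = (λ ν → ξ ν ℚ.+ χ ν) , λ R s → let open Reals R in
    trans (+-cong (f≈ R s) (g≈ R s)) (trans (sym (sumOver-+ (partitionsUpTo d) _ _))
      (sumOver-cong (partitionsUpTo d)
        (λ ν → sym (trans (*-congʳ (fromℚ-+ (ξ ν) (χ ν))) (distribʳ _ _ _)))))

  expressible-scale : ∀ x {d f} → Expressible d f →
                      Expressible d (λ R s → let open Reals R in fromℚ x * f R s)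
  expressible-scale x {d} (ξ , f≈) = (λ ν → x ℚ.* ξ ν) , λ R s → let open Reals R in
    trans (*-congˡ (f≈ R s)) (trans (sym (sumOver-* (partitionsUpTo d) _ _))
      (sumOver-cong (partitionsUpTo d)
        (λ ν → sym (trans (*-congʳ (fromℚ-* x (ξ ν))) (*-assoc _ _ _)))))

  -- The coefficient family is 1 at `ν` and 0 elsewhere; as `ν` occurs exactly once in
  -- `partitionsUpTo d`, one term survives.
  expressible-monomial : ∀ {d} ν → ∣ ν ∣ ℕ.≤ d →
    Expressible d (λ R s → let open AtSequence s in q ν a b)
  expressible-monomial {d} ν ∣ν∣≤d = indicator , λ R s → let open AtSequence s in
    sym (trans
      (sumOver-single (partitionsUpTo-unique d) (partitionsUpTo-complete d ν ∣ν∣≤d)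
        (λ μ μ≢ν → trans (*-congʳ (trans (reflexive (≡.cong fromℚ (indicator-≢ μ≢ν))) fromℚ-0)) (zeroˡ _)))
      (trans (*-congʳ (trans (reflexive (≡.cong fromℚ indicator-≡)) fromℚ-1)) (*-identityˡ _)))
    where
    indicator : Partition → ℚ
    -- Partitions with equal `parts` are equal, so comparing lists decides equality.
    indicator μ with ≡-dec ℕₚ._≟_ (parts μ) (parts ν)
    ... | yes _ = 1ℚ
    ... | no  _ = 0ℚ
    indicator-≢ : ∀ {μ} → μ ≢ ν → indicator μ ≡ 0ℚ
    indicator-≢ {μ} μ≢ν with ≡-dec ℕₚ._≟_ (parts μ) (parts ν)
    ... | yes eq = contradiction (parts-injective eq) μ≢ν
    ... | no  _  = ≡.refl
    indicator-≡ : indicator ν ≡ 1ℚ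
    indicator-≡ with ≡-dec ℕₚ._≟_ (parts ν) (parts ν)
    ... | yes _  = ≡.refl
    ... | no neq = contradiction ≡.refl neq

  expressible-sumOver : ∀ {A : Set} {d} (xs : List A) {f : A → Quantity} →
    (∀ {x} → x ∈ xs → Expressible d (f x)) →
    Expressible d (λ R s → RealNotation.sumOver R xs (λ x → f x R s))
  expressible-sumOver []       f-expr = expressible-zero
  expressible-sumOver (x ∷ xs) f-expr =
    expressible-+ (f-expr (here ≡.refl)) (expressible-sumOver xs (f-expr ∘ there))

  -- Multiplying q_ν by q_{r+1} inserts the part `suc r`, which raises the size by r + 1; the
  -- product is thus a sum of scaled monomials of size at most `e`.
  expressible-powerDiff : ∀ r {d e f} → suc r ℕ.+ d ℕ.≤ e → Expressible d f →
    Expressible e (λ R s → let open AtSequence s in powerDiff (suc r) a b * f R s)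
  expressible-powerDiff r {d} {e} r+d≤e (ξ , f≈) = expressible-cong
    (λ R s → let open AtSequence s in sym (trans (*-congˡ (f≈ R s))
      (trans (sym (sumOver-* (partitionsUpTo d) _ _)) (sumOver-cong (partitionsUpTo d)
        (λ ν → trans (x*yz≈y*xz _ _ _) (*-congˡ (sym (q-insertPart r ν a b))))))))
    (expressible-sumOver (partitionsUpTo d) λ {ν} ν∈ →
      expressible-scale (ξ ν) (expressible-monomial (insertPart r ν)
        (ℕₚ.≤-trans (ℕₚ.≤-reflexive (∣insertPart∣ r ν))
          (ℕₚ.≤-trans (ℕₚ.+-monoʳ-≤ (suc r) (partitionsUpTo-sound d ν∈)) r+d≤e))))

  -- Each summand pairs the power difference of degree r + t + 1 with h at n - r, so no degree
  -- exceeds t + 1 + n. The offset `t` is there because the recursion of `conv` shifts its first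
  -- series.
  expressible-conv : ∀ t n {e} → suc t ℕ.+ n ℕ.≤ e →
    (∀ {j} → j ℕ.≤ n → Expressible j (λ R s → NewtonSequence.h s j)) →
    Expressible e (λ R s → let open AtSequence s in
      conv (λ r → powerDiff (suc (r ℕ.+ t)) a b) h n)
  expressible-conv t zero    le h-expr = expressible-powerDiff t le (h-expr z≤n)
  expressible-conv t (suc n) {e} le h-expr = expressible-+
    (expressible-powerDiff t le (h-expr ℕₚ.≤-refl))
    (expressible-cong
      (λ R s → let open AtSequence s in
        conv-cong (λ r → reflexive (≡.cong (λ i → powerDiff (suc i) a b) (ℕₚ.+-suc r t))) (λ _ → refl) n)
      (expressible-conv (suc t) n
        (≡.subst (ℕ._≤ e) (≡.cong suc (ℕₚ.+-suc t n)) le)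
        (h-expr ∘ ℕₚ.m≤n⇒m≤1+n)))

  -- Given directly in lowest terms, so that its numerator and denominator compute.
  1/suc : ℕ → ℚ
  1/suc n = mkℚ (ℤ.+ 1) n (1-coprimeTo (suc n))

  -- Complete induction, because the recursion for the next value involves all earlier ones.
  -- Dividing it by n + 1 is where fractions enter.
  expressible-h : ∀ k → Expressible k (λ R s → NewtonSequence.h s k)
  expressible-h = <-rec _ step
    where
    step : ∀ k → (∀ {j} → j ℕ.< k → Expressible j (λ R s → NewtonSequence.h s j)) →
           Expressible k (λ R s → NewtonSequence.h s k)
    -- The initial value 1 is the monomial of the empty partition.
    step zero    rec = expressible-cong (λ R s → RealNumbers.sym R (NewtonSequence.h-zero s))
                         (expressible-monomial (mkPartition [] [] []) z≤n)
    step (suc n) rec = expressible-cong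
      (λ R s → let open AtSequence s in ↧-cancel (ℚ.toℚᵘ (1/suc n)) (begin
        suc n · 1# * (fromℚ (1/suc n) * conv (λ r → powerDiff (suc (r ℕ.+ 0)) a b) h n)
          ≈⟨ *-assoc _ _ _ ⟨
        (suc n · 1# * fromℚ (1/suc n)) * conv (λ r → powerDiff (suc (r ℕ.+ 0)) a b) h n
          ≈⟨ *-cong (trans (↧*fromℚ≈↥ (1/suc n)) (+-identityʳ 1#))
               (conv-cong (λ r → reflexive (≡.cong (λ i → powerDiff (suc i) a b) (ℕₚ.+-identityʳ r))) (λ _ → refl) n) ⟩
        1# * conv (λ r → powerDiff (suc r) a b) h n
          ≈⟨ *-identityˡ _ ⟩
        conv (λ r → powerDiff (suc r) a b) h n
          ≈⟨ h-suc n ⟨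
        suc n · 1# * h (suc n) ∎))
      (expressible-scale (1/suc n) (expressible-conv 0 n ℕₚ.≤-refl (rec ∘ s≤s)))

-- The left-hand side as a solution of Newton's identities.

momentSequence : ∀ {c ℓ₁ ℓ₂} (R : RealNumbers c ℓ₁ ℓ₂) → let open Reals R in
  ∀ {m} {a w : Vector ℝ (suc m)} (b : Vector ℝ m) → InvertsDenominator a w → NewtonSequence R
momentSequence R {a = a} {w} b inv = record
  { a      = a
  ; b      = b
  ; h      = moment a w b
  ; h-zero = moment-zero b inv
  ; h-suc  = λ n → x-y≈0⇒x≈y (moment-newton b inv n)
  }
  where open Reals R

theorem3p2 : ∀ {c ℓ₁ ℓ₂} (k : ℕ) →
    Σ[ ξ ∈ (Partition → ℚ) ]
    ((R : RealNumbers c ℓ₁ ℓ₂) → let open RealNotation R in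
    (m : ℕ) (a : Vector ℝ (suc m)) (b : Vector ℝ m) →
    (a↑ : StrictlyIncreasing a) → StrictlyIncreasing b →
    sum (λ i → product (λ j → a i - b j) / denominator a i [ denominator#0 a↑ i ] * a i ^ k)
    ≈ sumOver (partitionsUpTo k) (λ ν → fromℚ (ξ ν) * q ν a b))
theorem3p2 k = let ξ , h≈ = expressible-h k in
  ξ , λ R m a b a↑ b↑ → h≈ R (momentSequence R b (λ i → Reals.reciprocal R (RealNotation.denominator#0 R a↑ i)))
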